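{- Let $k > d \geq 1$ and $1 < q \leq k$ be integers. There is a function $f = f_{k,d,q} : \mathbb{N} \to \mathbb{R}$ with $f(N) \to 0$ as $N \to \infty$ such that for every positive integer $n$ with $q \mid n-2$, setting $N = (k-1)n - k + 2$, there exists an $N$-vertex $k$-graph $H$ with $\delta_d(H) \geq (1/q - f(N)) \binom{N-d}{k-d}$ that does not contain the $k$-expansion of any $n$-vertex tree all of whose vertex degrees are congruent to $1$ modulo $q$.
   Context: A $k$-graph is a $k$-uniform hypergraph. For a $k$-graph $H$ and $S \subseteq V(H)$, $\deg_H(S)$ is the number of edges containing $S$, and $\delta_d(H)$ is the minimum of $\deg_H(S)$ over all $d$-subsets $S \subseteq V(H)$. The $k$-expansion $T^{(k)}$ of a graph $T$ is the $k$-graph obtained by replacing each edge $uv$ of $T$ by a $k$-edge consisting of $u$, $v$ and $k-2$ new vertices that belong to no other edge. "Contain" means as a (not necessarily induced) subgraph. -}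

module Defs where

open import Data.Bool.Properties using () renaming (_≟_ to _≟ᵇ_)
open import Data.Fin using (Fin; zero; suc; inject₁; fromℕ; _<_)
open import Data.Fin.Properties using (_≟_; _<?_; any?)
open import Data.Fin.Subset using (Subset; inside; outside; _∈_; _⊆_; ⊥; ⊤; ⁅_⁆; _∪_; ∣_∣)
open import Data.Fin.Subset.Properties using (_∈?_; _⊆?_)
open import Data.Integer using (ℤ; _-_)
open import Data.Integer.Divisibility using (_∣_)
open import Data.List as List using (List; []; _∷_; _++_; map; filter; length; allFin; cartesianProduct)
open import Data.List.Extrema.Nat using (min)
open import Data.Nat as ℕ using (ℕ; zero; suc; _+_; _*_; _∸_; _≥_)
open import Data.Product using (_×_; _,_; proj₁; proj₂; ∃; ∃-syntax)
open import Data.Rational as ℚ using (ℚ; 0ℚ)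
open import Data.Vec as Vec using ([]; _∷_; tabulate; replicate; concat; _[_]≔_)
open import Data.Vec.Properties using (≡-dec)
open import Function.Definitions using (Injective)
open import Relation.Binary using (Rel; Irreflexive; Symmetric) renaming (Decidable to Decidable₂)
open import Relation.Binary.Construct.Closure.ReflexiveTransitive using (Star)
open import Relation.Binary.PropositionalEquality using (_≡_)
open import Relation.Nullary using (¬_; does)
open import Relation.Nullary.Decidable using (_×-dec_)
open import Relation.Unary using (Pred; Decidable)
open import Level using (0ℓ)

infix 4 _≡_[mod_]

_≡_[mod_] : ℤ → ℤ → ℤ → Set
a ≡ b [mod q ] = q ∣ a - b

-- Rational values suffice for a sequence tending to 0 that is only used as an
-- error bound: a real null sequence f is dominated by a rational null sequence
-- (round f N up by at most 1/(N+1)).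
TendsToZero : (ℕ → ℚ) → Set
TendsToZero f = ∀ ε → 0ℚ ℚ.< ε → ∃[ N₀ ] ∀ N → N ≥ N₀ → ℚ.∣ f N ∣ ℚ.< ε

record Hypergraph (N : ℕ) : Set₁ where
  field
    Edge  : Pred (Subset N) 0ℓ
    edge? : Decidable Edge

open Hypergraph public

Uniform : ∀ {N} → ℕ → Hypergraph N → Set
Uniform k H = ∀ e → Edge H e → ∣ e ∣ ≡ k

subsets : ∀ N → List (Subset N)
subsets zero    = [] ∷ []
subsets (suc N) = map (outside ∷_) (subsets N) ++ map (inside ∷_) (subsets N)

subsetsOfSize : ∀ N → ℕ → List (Subset N)
subsetsOfSize N d = filter (λ S → ∣ S ∣ ℕ.≟ d) (subsets N)

edgesOf : ∀ {N} → Hypergraph N → List (Subset N)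
edgesOf {N} H = filter (edge? H) (subsets N)

deg : ∀ {N} → Hypergraph N → Subset N → ℕ
deg H S = length (filter (S ⊆?_) (edgesOf H))

-- `min` takes a starting value for the minimum.  The total number of edges is
-- an upper bound for every deg H S, so it does not affect the minimum as soon
-- as there is a d-subset, i.e. whenever d ≤ N.
δ : ∀ {N} → ℕ → Hypergraph N → ℕ
δ {N} d H = min (length (edgesOf H)) (map (deg H) (subsetsOfSize N d))

image : ∀ {m N} → (Fin m → Fin N) → Subset m → Subset N
image φ e = tabulate λ y → does (any? λ x → (x ∈? e) ×-dec (φ x ≟ y))

Contains : ∀ {m N} → Hypergraph N → Hypergraph m → Set
Contains {m} {N} H G =
  ∃ λ (φ : Fin m → Fin N) → Injective _≡_ _≡_ φ × (∀ e → Edge G e → Edge H (image φ e))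

record Graph (n : ℕ) : Set₁ where
  field
    Adj    : Rel (Fin n) 0ℓ
    adj?   : Decidable₂ Adj
    sym    : Symmetric Adj
    irrefl : Irreflexive _≡_ Adj

open Graph public

degree : ∀ {n} → Graph n → Fin n → ℕ
degree {n} T v = length (filter (adj? T v) (allFin n))

-- Each undirected edge is listed once, as the pair (u , v) with u < v.
graphEdges : ∀ {n} → Graph n → List (Fin n × Fin n)
graphEdges {n} T =
  filter (λ (u , v) → (u <? v) ×-dec adj? T u v) (cartesianProduct (allFin n) (allFin n))

Connected : ∀ {n} → Graph n → Set
Connected T = ∀ u v → Star (Adj T) u v

-- A cycle of length 3 + m.
Cycle : ∀ {n} → Graph n → Set
Cycle {n} T = ∃[ m ] ∃ λ (c : Fin (3 + m) → Fin n) →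
  Injective _≡_ _≡_ c ×
  (∀ i → Adj T (c (inject₁ i)) (c (suc i))) ×
  Adj T (c (fromℕ (2 + m))) (c zero)

IsTree : ∀ {n} → Graph n → Set
IsTree T = Connected T × ¬ Cycle T

∥_∥ : ∀ {n} → Graph n → ℕ
∥ T ∥ = length (graphEdges T)

-- The first n vertices are those of T; they are followed by one block of k - 2
-- new vertices for each edge of T.  The i-th edge uv of T becomes {u , v}
-- together with the whole i-th block.
expansionEdge : ∀ {n} k (T : Graph n) → Fin ∥ T ∥ → Subset (n + ∥ T ∥ * (k ∸ 2))
expansionEdge k T i =
  (⁅ proj₁ uv ⁆ ∪ ⁅ proj₂ uv ⁆) Vec.++ concat (replicate ∥ T ∥ ⊥ [ i ]≔ ⊤)
  where uv = List.lookup (graphEdges T) i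

expansion : ∀ {n} k (T : Graph n) → Hypergraph (n + ∥ T ∥ * (k ∸ 2))
expansion k T = record
  { Edge  = λ e → ∃[ i ] e ≡ expansionEdge k T i
  ; edge? = λ e → any? λ i → ≡-dec _≟ᵇ_ e (expansionEdge k T i)
  }

module Submission where

open import Defs hiding (sym)
open import Data.Bool using (true; false; if_then_else_)
open import Data.Fin as Fin using (Fin; zero; suc; toℕ; fromℕ<; _↑ˡ_; _↑ʳ_; punchIn; punchOut)
open import Data.Fin.Permutation using (permutation)
open import Data.Fin.Properties as Fin using (any?; injective⇒≤; punchInᵢ≢i; punchOut-cong; punchOut-injective; punchOut-punchIn; toℕ-fromℕ<; ↑ˡ-injective)
open import Data.Fin.Subset using (Subset; inside; outside; _∈_; _⊆_; ∣_∣; ⊥; ⊤; ⁅_⁆; _∪_)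
open import Data.Fin.Subset.Properties using (_∈?_; _⊆?_; out⊆; s⊆s; ∣⊥∣≡0; ∪-identityˡ; ∪-identityʳ)
open import Data.Integer as ℤ using (+≤+; +<+)
import Data.Integer.Properties as ℤ
import Data.Integer.Tactic.RingSolver as ℤSolver
open import Data.List as List using (List; []; _∷_; _++_; map; filter; length; allFin; cartesianProduct)
open import Data.List.Extrema.Nat using (argmin-all)
open import Data.List.Membership.Propositional using () renaming (_∈_ to _∈ᴸ_)
open import Data.List.Membership.Propositional.Properties using (∈-allFin; ∈-cartesianProduct⁺; ∈-filter⁺; ∈-lookup)
open import Data.List.Properties using (filter-++; length-++; length-filter; map-++; map-tabulate; map-∘)
open import Data.List.Relation.Unary.All as All using (All; []; _∷_)
open import Data.List.Relation.Unary.All.Properties as All using (all-filter)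
open import Data.List.Relation.Unary.Any using (index)
open import Data.List.Relation.Unary.Any.Properties using (lookup-index)
open import Data.Nat hiding (_/_)
open import Data.Nat.Combinatorics
open import Data.Nat.DivMod using (_%_; m%n<n; m≡m%n+[m/n]*n) renaming (_/_ to _div_)
open import Data.Nat.Divisibility using (divides; _∣0; n∣m*n; m∣m*n; ∣1⇒≡1; ∣m∣n⇒∣m+n; ∣m+n∣m⇒∣n; ∣-refl) renaming (_∣_ to _∣ₙ_; _∣?_ to _∣ₙ?_)
open import Data.Nat.ListAction using () renaming (sum to sumᴸ)
open import Data.Nat.ListAction.Properties using (sum-++)
open import Data.Nat.Properties
open import Data.Nat.Tactic.RingSolver using (solve-∀)
open import Data.Product using (∃; ∃₂; ∃-syntax; _×_; _,_; proj₁; proj₂)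
open import Data.Rational as ℚ using (ℚ; _/_; mkℚ; *<*; toℚᵘ)
import Data.Rational.Properties as ℚ
open import Data.Rational.Unnormalised as ℚᵘ using (mkℚᵘ; *≤*)
import Data.Rational.Unnormalised.Properties as ℚᵘ
open import Data.Sum using (_⊎_; inj₁; inj₂)
open import Data.Vec as Vec using ([]; _∷_; concat; lookup; replicate; _[_]≔_)
open import Data.Vec.Properties using (lookup∘tabulate; lookup⇒[]=; []=⇒lookup)
open import Function using (id; _∘_)
open import Function.Definitions using (Injective)
open import Relation.Binary.Construct.Closure.ReflexiveTransitive using (Star; ε; _◅_)
open import Relation.Binary.Definitions using (tri<; tri≈; tri>)
open import Relation.Binary.PropositionalEquality
open import Relation.Nullary
open import Relation.Nullary.Decidable using (_×-dec_)
open import Relation.Unary using (Pred; Decidable)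
open import Algebra.Properties.Semiring.Sum +-*-semiring using (sum; sum-cong-≗; sum-syntax; sum-replicate-zero; ∑-comm; ∑-distrib-+; ∑-permute; *-distribʳ-sum)

-- Label the vertices with 0, 1, 2, … and let H consist of the k-sets whose label
-- sum plus an offset s is divisible by q.  A (k-d)-subset completing a given
-- d-set is built by adding its last vertex in one residue class mod q, and the
-- classes are balanced, so a proportion 1/q - O(1/N) of the completions are edges.
-- An expansion copy is spanning, and its edges cover a vertex of T as often as its
-- degree, ≡ 1 mod q, and every other vertex once.  Hence the label sums of
-- the n - 1 ≡ 1 edges add up to the total label sum W, while being edges of H
-- they add up to -s; choosing s with W + s ≡ 1 excludes this.
-- The count ∥T∥ = n - 1 follows from connectedness and, for k ≥ 3, from the
-- injectivity of the copy.  For k = 2 the latter says nothing; there s = 0 makes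
-- H the disjoint union of two cliques, which contains no connected spanning graph.

-- Counting the completions of a vertex set to an edge

dvd : ℕ → ℕ → ℕ
dvd q s = if does (q ∣ₙ? s) then 1 else 0

dvd≤1 : ∀ q s → dvd q s ≤ 1
dvd≤1 q s with does (q ∣ₙ? s)
... | true  = ≤-refl
... | false = z≤n

dvd≡1 : ∀ q s → q ∣ₙ s → dvd q s ≡ 1
dvd≡1 q s q∣s with q ∣ₙ? s
... | yes _ = refl
... | no ¬p = contradiction q∣s ¬p

C-pascal : ∀ n k → suc n C suc k ≡ n C k + n C suc k
C-pascal n k = sym (nCk+nC[k+1]≡[n+1]C[k+1] n k)

-- Absorption gives (k+1) C(n,k+1) = (n-k) C(n,k); weakening n-k to n avoids truncated subtraction
-- and makes the induction by Pascal's rule immediate.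
C-absorb-≤ : ∀ n k → suc k * (n C suc k) ≤ n * (n C k)
C-absorb-≤ zero k = ≤-reflexive (*-zeroʳ (suc k))
C-absorb-≤ (suc n) zero = ≤-reflexive (begin-equality
  1 * (suc n C 1)     ≡⟨ cong (1 *_) (nC1≡n (suc n)) ⟩
  1 * suc n           ≡⟨ *-comm 1 (suc n) ⟩
  suc n * 1           ∎)
  where open ≤-Reasoning
C-absorb-≤ (suc n) (suc k) = begin
  (2 + k) * (suc n C (2 + k))             ≡⟨ cong ((2 + k) *_) (C-pascal n (suc k)) ⟩
  (2 + k) * (y + z)                       ≡⟨ split k y z ⟩
  (suc k * y + y) + (2 + k) * z           ≤⟨ +-mono-≤ (+-monoˡ-≤ y (C-absorb-≤ n k)) (C-absorb-≤ n (suc k)) ⟩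
  (n * x + y) + n * y                     ≤⟨ +-monoˡ-≤ (n * y) (+-monoˡ-≤ y (m≤n+m (n * x) x)) ⟩
  ((x + n * x) + y) + n * y               ≡⟨ regroup n x y ⟩
  suc n * (x + y)                         ≡⟨ cong (suc n *_) (C-pascal n k) ⟨
  suc n * (suc n C suc k)                 ∎
  where
  open ≤-Reasoning
  x = n C k
  y = n C suc k
  z = n C (2 + k)
  split : ∀ k y z → (2 + k) * (y + z) ≡ (suc k * y + y) + (2 + k) * z
  split = solve-∀
  regroup : ∀ n x y → ((x + n * x) + y) + n * y ≡ suc n * (x + y)
  regroup = solve-∀

-- The number of m-element subfamilies of L whose sum, increased by s, is
-- divisible by q.
count : ℕ → List ℕ → ℕ → ℕ → ℕ
count q []      zero    s = dvd q s
count q []      (suc m) s = 0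
count q (x ∷ L) zero    s = count q L zero s
count q (x ∷ L) (suc m) s = count q L (suc m) s + count q L m (x + s)

-- K is kept apart from L so that an induction on L can leave the range of the last entry fixed.
-- When K is L, that entry may already belong to the subfamily.
extensions : ℕ → List ℕ → List ℕ → ℕ → ℕ → ℕ
extensions q []      L m s = 0
extensions q (v ∷ K) L m s = count q L m (v + s) + extensions q K L m s

count-≤C : ∀ q L m s → count q L m s ≤ length L C m
count-≤C q []      zero    s = dvd≤1 q s
count-≤C q []      (suc m) s = z≤n
count-≤C q (x ∷ L) zero    s = count-≤C q L 0 s
count-≤C q (x ∷ L) (suc m) s = begin
  count q L (suc m) s + count q L m (x + s) ≤⟨ +-mono-≤ (count-≤C q L (suc m) s) (count-≤C q L m (x + s)) ⟩
  length L C suc m + length L C m           ≡⟨ +-comm (length L C suc m) _ ⟩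
  length L C m + length L C suc m           ≡⟨ C-pascal (length L) m ⟨
  suc (length L) C suc m                    ∎
  where open ≤-Reasoning

extensions-zero : ∀ q K x L s → extensions q K (x ∷ L) 0 s ≡ extensions q K L 0 s
extensions-zero q []      x L s = refl
extensions-zero q (v ∷ K) x L s = cong (count q L 0 (v + s) +_) (extensions-zero q K x L s)

extensions-suc : ∀ q K x L m s →
  extensions q K (x ∷ L) (suc m) s ≡ extensions q K L (suc m) s + extensions q K L m (x + s)
extensions-suc q []      x L m s = refl
extensions-suc q (v ∷ K) x L m s = begin
  (a + count q L m (x + (v + s))) + extensions q K (x ∷ L) (suc m) s
    ≡⟨ cong₂ (λ t u → (a + count q L m t) + u) (swap x v s) (extensions-suc q K x L m s) ⟩
  (a + b) + (c + d)
    ≡⟨ interchange a b c d ⟩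
  (a + c) + (b + d) ∎
  where
  open ≡-Reasoning
  a = count q L (suc m) (v + s)
  b = count q L m (v + (x + s))
  c = extensions q K L (suc m) s
  d = extensions q K L m (x + s)
  swap : ∀ a b c → a + (b + c) ≡ b + (a + c)
  swap = solve-∀
  interchange : ∀ a b c d → (a + b) + (c + d) ≡ (a + c) + (b + d)
  interchange = solve-∀

-- Every (m+1)-family of zero sum arises from m+1 extensions of an m-family; the
-- other extensions reuse a member of the m-family.
extensions-≤ : ∀ q L m s →
  extensions q L L m s ≤ suc m * count q L (suc m) s + m * (length L C m)
extensions-≤ q []      m s = z≤n
extensions-≤ q (x ∷ L) zero s = begin
  count q L 0 (x + s) + extensions q L (x ∷ L) 0 s        ≡⟨ cong (count q L 0 (x + s) +_) (extensions-zero q L x L s) ⟩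
  count q L 0 (x + s) + extensions q L L 0 s              ≤⟨ +-monoʳ-≤ (count q L 0 (x + s)) (extensions-≤ q L 0 s) ⟩
  count q L 0 (x + s) + (1 * count q L 1 s + 0)           ≡⟨ rearrange (count q L 0 (x + s)) (count q L 1 s) ⟩
  1 * (count q L 1 s + count q L 0 (x + s)) + 0           ∎
  where
  open ≤-Reasoning
  rearrange : ∀ a b → a + (1 * b + 0) ≡ 1 * (b + a) + 0
  rearrange = solve-∀
extensions-≤ q (x ∷ L) (suc m) s = begin
  (a + b) + extensions q L (x ∷ L) (suc m) s
    ≡⟨ cong ((a + b) +_) (extensions-suc q L x L m s) ⟩
  (a + b) + (extensions q L L (suc m) s + extensions q L L m (x + s))
    ≤⟨ +-mono-≤ (+-monoʳ-≤ a (count-≤C q L m _)) (+-mono-≤ (extensions-≤ q L (suc m) s) (extensions-≤ q L m (x + s))) ⟩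
  (a + y) + (((2 + m) * c + suc m * z) + (suc m * a + m * y))
    ≡⟨ rearrange a c y z m ⟩
  (2 + m) * (c + a) + suc m * (y + z)
    ≡⟨ cong (λ t → (2 + m) * (c + a) + suc m * t) (C-pascal (length L) m) ⟨
  (2 + m) * (c + a) + suc m * (suc (length L) C suc m) ∎
  where
  open ≤-Reasoning
  a = count q L (suc m) (x + s)
  b = count q L m (x + (x + s))
  c = count q L (2 + m) s
  y = length L C m
  z = length L C suc m
  rearrange : ∀ a c y z m → (a + y) + (((2 + m) * c + suc m * z) + (suc m * a + m * y)) ≡ (2 + m) * (c + a) + suc m * (y + z)
  rearrange = solve-∀

-- The hypothesis says that every residue class holds at least (A - B)/q entries of K. So every
-- m-subfamily of L has at least that many extensions by K, and Pascal's rule sums this over the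
-- subfamilies.
extensions-≥ : ∀ q A B K → (∀ s → A ≤ B + q * extensions q K [] 0 s) → ∀ L m s →
  A * (length L C m) ≤ B * (length L C m) + q * extensions q K L m s
extensions-≥ q A B K h [] zero s = begin
  A * 1                                ≡⟨ *-identityʳ A ⟩
  A                                    ≤⟨ h s ⟩
  B + q * extensions q K [] 0 s        ≡⟨ cong (_+ q * extensions q K [] 0 s) (*-identityʳ B) ⟨
  B * 1 + q * extensions q K [] 0 s    ∎
  where open ≤-Reasoning
extensions-≥ q A B K h [] (suc m) s
  rewrite *-zeroʳ A = z≤n
extensions-≥ q A B K h (x ∷ L) zero s
  rewrite extensions-zero q K x L s = extensions-≥ q A B K h L zero s
extensions-≥ q A B K h (x ∷ L) (suc m) s = begin
  A * (suc (length L) C suc m)       ≡⟨ cong (A *_) (C-pascal (length L) m) ⟩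
  A * (y + z)                        ≡⟨ *-distribˡ-+ A y z ⟩
  A * y + A * z                      ≤⟨ +-mono-≤ (extensions-≥ q A B K h L m (x + s)) (extensions-≥ q A B K h L (suc m) s) ⟩
  (B * y + q * e) + (B * z + q * f)  ≡⟨ rearrange B y z q e f ⟩
  B * (y + z) + q * (f + e)          ≡⟨ cong₂ (λ u v → B * u + q * v) (C-pascal (length L) m) (extensions-suc q K x L m s) ⟨
  B * (suc (length L) C suc m) + q * extensions q K (x ∷ L) (suc m) s ∎
  where
  open ≤-Reasoning
  y = length L C m
  z = length L C suc m
  e = extensions q K L m (x + s)
  f = extensions q K L (suc m) s
  rearrange : ∀ B y z q e f → (B * y + q * e) + (B * z + q * f) ≡ B * (y + z) + q * (f + e)
  rearrange = solve-∀

weight : ∀ {N} → (Fin N → ℕ) → Subset N → ℕ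
weight {N} w e = ∑[ x < N ] (if lookup e x then w x else 0)

-- Only vertices outside S contribute: they are the candidates for completing S to an edge.
labels : ∀ {N} → (Fin N → ℕ) → Subset N → List ℕ
labels w []            = []
labels w (inside  ∷ S) = labels (w ∘ suc) S
labels w (outside ∷ S) = w zero ∷ labels (w ∘ suc) S

length-labels : ∀ {N} (w : Fin N → ℕ) S → length (labels w S) ≡ N ∸ ∣ S ∣
length-labels w S = trans (sym (m+n∸m≡n ∣ S ∣ _)) (cong (_∸ ∣ S ∣) (go w S))
  where
  go : ∀ {N} (w : Fin N → ℕ) S → ∣ S ∣ + length (labels w S) ≡ N
  go w []            = refl
  go w (inside  ∷ S) = cong suc (go (w ∘ suc) S)
  go w (outside ∷ S) = trans (+-suc ∣ S ∣ _) (cong suc (go (w ∘ suc) S))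

-- ρ is the distance from a + s to the next multiple of q.
residue-class-≥ : ∀ q ρ {N} (w : Fin N → ℕ) a s S → (∀ x → w x ≡ a + toℕ x) → suc q ∣ₙ a + s + ρ →
  N ≤ ρ + suc q * (∣ S ∣ + extensions (suc q) (labels w S) [] 0 s)
residue-class-≥ q ρ w a s [] _ _ = z≤n
residue-class-≥ q (suc ρ) {suc N} w a s (b ∷ S) w≡ q∣ = begin
  suc N                                              ≤⟨ s≤s (residue-class-≥ q ρ (w ∘ suc) (suc a) s S (λ x → trans (w≡ (suc x)) (+-suc a _)) (subst (suc q ∣ₙ_) (+-suc (a + s) ρ) q∣)) ⟩
  suc ρ + suc q * (∣ S ∣ + extensions (suc q) (labels (w ∘ suc) S) [] 0 s) ≤⟨ +-monoʳ-≤ (suc ρ) (*-monoʳ-≤ (suc q) (mono b)) ⟩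
  suc ρ + suc q * (∣ b ∷ S ∣ + extensions (suc q) (labels w (b ∷ S)) [] 0 s) ∎
  where
  open ≤-Reasoning
  mono : ∀ b → ∣ S ∣ + extensions (suc q) (labels (w ∘ suc) S) [] 0 s ≤ ∣ b ∷ S ∣ + extensions (suc q) (labels w (b ∷ S)) [] 0 s
  mono inside  = n≤1+n _
  mono outside = +-monoʳ-≤ ∣ S ∣ (m≤n+m _ _)
-- The first vertex lies in the wanted class. It is paid for by `∣ S ∣` or by `extensions`,
-- whichever side of S it is on, and the distance restarts at q from the second vertex.
residue-class-≥ q zero {suc N} w a s (b ∷ S) w≡ q∣ = begin
  suc N                                              ≤⟨ s≤s (residue-class-≥ q q (w ∘ suc) (suc a) s S (λ x → trans (w≡ (suc x)) (+-suc a _)) q∣′) ⟩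
  suc (q + suc q * z)                                ≡⟨ *-suc (suc q) z ⟨
  suc q * suc z                                      ≤⟨ *-monoʳ-≤ (suc q) (mono b) ⟩
  suc q * (∣ b ∷ S ∣ + extensions (suc q) (labels w (b ∷ S)) [] 0 s) ∎
  where
  open ≤-Reasoning
  z = ∣ S ∣ + extensions (suc q) (labels (w ∘ suc) S) [] 0 s
  q∣a+s : suc q ∣ₙ a + s
  q∣a+s = subst (suc q ∣ₙ_) (+-identityʳ (a + s)) q∣
  q∣′ : suc q ∣ₙ suc (a + s + q)
  q∣′ = subst (suc q ∣ₙ_) (+-suc (a + s) q) (∣m∣n⇒∣m+n q∣a+s ∣-refl)
  w₀≡a : w zero ≡ a
  w₀≡a = trans (w≡ zero) (+-identityʳ a)
  mono : ∀ b → suc z ≤ ∣ b ∷ S ∣ + extensions (suc q) (labels w (b ∷ S)) [] 0 s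
  mono inside  = ≤-refl
  mono outside rewrite w₀≡a | dvd≡1 (suc q) (a + s) q∣a+s = ≤-reflexive (sym (+-suc ∣ S ∣ _))

filter-map-length : ∀ {a b} {A : Set a} {B : Set b} {p} {P : Pred B p} (P? : Decidable P) (f : A → B) xs →
  length (filter P? (map f xs)) ≡ length (filter (P? ∘ f) xs)
filter-map-length P? f []       = refl
filter-map-length P? f (x ∷ xs) with does (P? (f x))
... | true  = cong suc (filter-map-length P? f xs)
... | false = filter-map-length P? f xs

length-filter-subsets : ∀ {N p} {P : Pred (Subset (suc N)) p} (P? : Decidable P) →
  length (filter P? (subsets (suc N))) ≡
  length (filter (P? ∘ (outside ∷_)) (subsets N)) + length (filter (P? ∘ (inside ∷_)) (subsets N))
length-filter-subsets {N} P? = begin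
  length (filter P? (map (outside ∷_) (subsets N) ++ map (inside ∷_) (subsets N)))
    ≡⟨ cong length (filter-++ P? (map (outside ∷_) (subsets N)) _) ⟩
  length (filter P? (map (outside ∷_) (subsets N)) ++ filter P? (map (inside ∷_) (subsets N)))
    ≡⟨ length-++ (filter P? (map (outside ∷_) (subsets N))) ⟩
  length (filter P? (map (outside ∷_) (subsets N))) + length (filter P? (map (inside ∷_) (subsets N)))
    ≡⟨ cong₂ _+_ (filter-map-length P? _ (subsets N)) (filter-map-length P? _ (subsets N)) ⟩
  _ ∎
  where open ≡-Reasoning

-- Adding to S the vertices of an m-subfamily of the outside labels gives a superset whose weight is
-- that of S plus the family's sum. In the recursion over the vertices, s absorbs the label of a
-- chosen vertex that is dropped.
count≤supersets : ∀ q {N p} (w : Fin N → ℕ) S m s {P : Pred (Subset N) p} (P? : Decidable P) →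
  (∀ e → S ⊆ e → ∣ e ∣ ≡ ∣ S ∣ + m → q ∣ₙ weight w e + s → P e) →
  count q (labels w S) m (weight w S + s) ≤ length (filter P? (subsets N))
count≤supersets q w [] (suc m) s P? h = z≤n
count≤supersets q w [] zero s P? h with q ∣ₙ? s | P? []
... | no _  | _     = z≤n
... | yes _ | yes _ = ≤-refl
... | yes d | no ¬p = contradiction (h [] (λ ()) refl d) ¬p
count≤supersets q {suc N} w (inside ∷ S) m s P? h = begin
  count q (labels (w ∘ suc) S) m (w zero + weight (w ∘ suc) S + s)
    ≡⟨ cong (count q (labels (w ∘ suc) S) m) (swap (w zero) (weight (w ∘ suc) S) s) ⟩
  count q (labels (w ∘ suc) S) m (weight (w ∘ suc) S + (w zero + s))
    ≤⟨ count≤supersets q (w ∘ suc) S m (w zero + s) (P? ∘ (inside ∷_))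
         (λ e S⊆e ∣e∣≡ q∣ → h (inside ∷ e) (s⊆s S⊆e) (cong suc ∣e∣≡)
            (subst (q ∣ₙ_) (sym (swap (w zero) (weight (w ∘ suc) e) s)) q∣)) ⟩
  length (filter (P? ∘ (inside ∷_)) (subsets N))
    ≤⟨ m≤n+m _ (length (filter (P? ∘ (outside ∷_)) (subsets N))) ⟩
  length (filter (P? ∘ (outside ∷_)) (subsets N)) + length (filter (P? ∘ (inside ∷_)) (subsets N))
    ≡⟨ length-filter-subsets P? ⟨
  length (filter P? (subsets (suc N))) ∎
  where
  open ≤-Reasoning
  swap : ∀ a b c → a + b + c ≡ b + (a + c)
  swap = solve-∀
count≤supersets q {suc N} w (outside ∷ S) zero s P? h = begin
  count q (labels (w ∘ suc) S) zero (weight (w ∘ suc) S + s)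
    ≤⟨ count≤supersets q (w ∘ suc) S zero s (P? ∘ (outside ∷_))
         (λ e S⊆e ∣e∣≡ q∣ → h (outside ∷ e) (out⊆ S⊆e) ∣e∣≡ q∣) ⟩
  length (filter (P? ∘ (outside ∷_)) (subsets N))
    ≤⟨ m≤m+n _ (length (filter (P? ∘ (inside ∷_)) (subsets N))) ⟩
  length (filter (P? ∘ (outside ∷_)) (subsets N)) + length (filter (P? ∘ (inside ∷_)) (subsets N))
    ≡⟨ length-filter-subsets P? ⟨
  length (filter P? (subsets (suc N))) ∎
  where open ≤-Reasoning
count≤supersets q {suc N} w (outside ∷ S) (suc m) s P? h = begin
  count q (labels (w ∘ suc) S) (suc m) (weight (w ∘ suc) S + s) + count q (labels (w ∘ suc) S) m (w zero + (weight (w ∘ suc) S + s))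
    ≡⟨ cong (λ t → count q (labels (w ∘ suc) S) (suc m) (weight (w ∘ suc) S + s) + count q (labels (w ∘ suc) S) m t)
         (swap (w zero) (weight (w ∘ suc) S) s) ⟩
  count q (labels (w ∘ suc) S) (suc m) (weight (w ∘ suc) S + s) + count q (labels (w ∘ suc) S) m (weight (w ∘ suc) S + (w zero + s))
    ≤⟨ +-mono-≤
         (count≤supersets q (w ∘ suc) S (suc m) s (P? ∘ (outside ∷_))
           (λ e S⊆e ∣e∣≡ q∣ → h (outside ∷ e) (out⊆ S⊆e) ∣e∣≡ q∣))
         (count≤supersets q (w ∘ suc) S m (w zero + s) (P? ∘ (inside ∷_))
           (λ e S⊆e ∣e∣≡ q∣ → h (inside ∷ e) (out⊆ S⊆e) (trans (cong suc ∣e∣≡) (sym (+-suc ∣ S ∣ m)))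
              (subst (q ∣ₙ_) (sym (trans (+-assoc (w zero) _ s) (swap (w zero) (weight (w ∘ suc) e) s))) q∣))) ⟩
  length (filter (P? ∘ (outside ∷_)) (subsets N)) + length (filter (P? ∘ (inside ∷_)) (subsets N))
    ≡⟨ length-filter-subsets P? ⟨
  length (filter P? (subsets (suc N))) ∎
  where
  open ≤-Reasoning
  swap : ∀ a b c → a + (b + c) ≡ b + (a + c)
  swap = solve-∀

-- The hypergraph and its minimum degree

divisibleWeight : ∀ N → ℕ → ℕ → ℕ → Hypergraph N
divisibleWeight N k q s = record
  { Edge  = λ e → ∣ e ∣ ≡ k × q ∣ₙ weight toℕ e + s
  ; edge? = λ e → (∣ e ∣ ≟ k) ×-dec (q ∣ₙ? (weight toℕ e + s))
  }

length-filter-filter : ∀ {a p r} {A : Set a} {P : Pred A p} {R : Pred A r} (P? : Decidable P) (R? : Decidable R) xs →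
  length (filter P? (filter R? xs)) ≡ length (filter (λ x → P? x ×-dec R? x) xs)
length-filter-filter P? R? []       = refl
length-filter-filter P? R? (x ∷ xs) with does (R? x)
... | true with does (P? x)
...   | true  = cong suc (length-filter-filter P? R? xs)
...   | false = length-filter-filter P? R? xs
length-filter-filter P? R? (x ∷ xs) | false with does (P? x)
...   | true  = length-filter-filter P? R? xs
...   | false = length-filter-filter P? R? xs

-- ρ is the residue of s * q, which is congruent to - s modulo q + 1.
next-multiple : ∀ q s → ∃[ ρ ] ρ ≤ q × suc q ∣ₙ s + ρ
next-multiple q s = (s * q) % suc q , s≤s⁻¹ (m%n<n (s * q) (suc q)) ,
  ∣m+n∣m⇒∣n (subst (suc q ∣ₙ_) split (n∣m*n s)) (n∣m*n ((s * q) div suc q))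
  where
  split : s * suc q ≡ (s * q) div suc q * suc q + (s + (s * q) % suc q)
  split = trans (*-suc s q) (trans (cong (s +_) (m≡m%n+[m/n]*n (s * q) (suc q)))
    (rearrange s ((s * q) % suc q) ((s * q) div suc q * suc q)))
    where
    rearrange : ∀ a b c → a + (b + c) ≡ c + (a + b)
    rearrange = solve-∀

-- Double counting of an m-family outside S together with a last vertex: `extensions-≥` bounds the
-- number of such pairs from below by the balance of the residue classes, `extensions-≤` from above
-- by m+1 times the degree plus the pairs that reuse a vertex.
deg-≥ : ∀ N q s d m (S : Subset N) → ∣ S ∣ ≡ d →
  N * ((N ∸ d) C m) ≤ suc q * suc (d + m) * ((N ∸ d) C m) + suc q * (suc m * deg (divisibleWeight N (d + suc m) (suc q) s) S)
deg-≥ N q s d m S refl = begin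
  N * c                                               ≡⟨ cong (λ l → N * (l C m)) ∣L∣ ⟨
  N * (length L C m)                                  ≤⟨ extensions-≥ (suc q) N B L classes L m (weight toℕ S + s) ⟩
  B * (length L C m) + suc q * E                      ≡⟨ cong (λ l → B * (l C m) + suc q * E) ∣L∣ ⟩
  B * c + suc q * E                                   ≤⟨ +-monoʳ-≤ (B * c) (*-monoʳ-≤ (suc q) E≤) ⟩
  B * c + suc q * (suc m * D + m * c)                 ≡⟨ rearrange q d m c D ⟩
  suc q * suc (d + m) * c + suc q * (suc m * D)       ∎
  where
  open ≤-Reasoning
  k = d + suc m
  H = divisibleWeight N k (suc q) s
  D = deg H S
  c = (N ∸ d) C m
  L = labels toℕ S
  ∣L∣ = length-labels toℕ S
  -- The summand d accounts for the vertices of S, which are missing from the classes; the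
  -- additional 1 covers the incomplete period at the start.
  B = suc q * suc d
  E = extensions (suc q) L L m (weight toℕ S + s)
  rearrange : ∀ q d m c D → suc q * suc d * c + suc q * (suc m * D + m * c) ≡ suc q * suc (d + m) * c + suc q * (suc m * D)
  rearrange = solve-∀
  classes : ∀ t → N ≤ B + suc q * extensions (suc q) L [] 0 t
  classes t with ρ , ρ≤q , q∣ ← next-multiple q t = begin
    N                                                       ≤⟨ residue-class-≥ q ρ toℕ 0 t S (λ _ → refl) q∣ ⟩
    ρ + suc q * (d + e)                                     ≤⟨ +-monoˡ-≤ (suc q * (d + e)) (≤-trans ρ≤q (n≤1+n q)) ⟩
    suc q + suc q * (d + e)                                 ≡⟨ *-suc (suc q) (d + e) ⟨
    suc q * (suc d + e)                                     ≡⟨ *-distribˡ-+ (suc q) (suc d) e ⟩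
    B + suc q * e                                           ∎
    where e = extensions (suc q) L [] 0 t
  count≤D : count (suc q) L (suc m) (weight toℕ S + s) ≤ D
  count≤D = begin
    count (suc q) L (suc m) (weight toℕ S + s)
      ≤⟨ count≤supersets (suc q) toℕ S (suc m) s (λ e → (S ⊆? e) ×-dec edge? H e) (λ e S⊆e ∣e∣≡ q∣ → S⊆e , ∣e∣≡ , q∣) ⟩
    length (filter (λ e → (S ⊆? e) ×-dec edge? H e) (subsets N))
      ≡⟨ length-filter-filter (S ⊆?_) (edge? H) (subsets N) ⟨
    D ∎
  E≤ : E ≤ suc m * D + m * c
  E≤ = begin
    E                                                                    ≤⟨ extensions-≤ (suc q) L m (weight toℕ S + s) ⟩
    suc m * count (suc q) L (suc m) (weight toℕ S + s) + m * (length L C m)  ≤⟨ +-mono-≤ (*-monoʳ-≤ (suc m) count≤D) (≤-reflexive (cong (λ l → m * (l C m)) ∣L∣)) ⟩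
    suc m * D + m * c                                                    ∎

subsetOfSize : ∀ {N d} → d ≤ N → ∃ λ (S : Subset N) → ∣ S ∣ ≡ d
subsetOfSize {N}     z≤n       = ⊥ , ∣⊥∣≡0 N
subsetOfSize {suc N} (s≤s d≤N) with S , ∣S∣≡d ← subsetOfSize d≤N = inside ∷ S , cong suc ∣S∣≡d

δ-≥ : ∀ N q s d m → d ≤ N →
  N * ((N ∸ d) C m) ≤ suc q * suc (d + m) * ((N ∸ d) C m) + suc q * (suc m * δ d (divisibleWeight N (d + suc m) (suc q) s))
δ-≥ N q s d m d≤N = argmin-all id {xs = List.map (deg H) (subsetsOfSize N d)} {P = Bounds} total
  (All.map⁺ (All.map (λ {S} → deg-≥ N q s d m S) (all-filter (λ S → ∣ S ∣ ≟ d) (subsets N))))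
  where
  H = divisibleWeight N (d + suc m) (suc q) s
  Bounds : ℕ → Set
  Bounds D = N * ((N ∸ d) C m) ≤ suc q * suc (d + m) * ((N ∸ d) C m) + suc q * (suc m * D)
  -- The starting value of the minimum must obey the bound too. It is at least the degree of any
  -- d-set, and d ≤ N provides one.
  total : Bounds (length (edgesOf H))
  total with S , ∣S∣≡d ← subsetOfSize d≤N = ≤-trans (deg-≥ N q s d m S ∣S∣≡d)
    (+-monoʳ-≤ (suc q * suc (d + m) * ((N ∸ d) C m)) (*-monoʳ-≤ (suc q) (*-monoʳ-≤ (suc m) (length-filter (S ⊆?_) (edgesOf H)))))

-- The bound on δ is relative to the binomial coefficient c with lower index m;
-- here it is transferred to the one with lower index m + 1, called c′.
rescale : ∀ N q K m c c′ D → suc m * c′ ≤ suc N * c → suc N * c ≤ suc q * K * c + suc q * (suc m * D) →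
  suc N * c′ ≤ suc q * (suc N * D) + suc q * (K * c′)
rescale N q K m c c′ D c′≤ h with ≤-total (suc N) (suc q * K)
-- Here the error term alone exceeds the left-hand side.
... | inj₁ small = ≤-trans (*-monoˡ-≤ c′ small) (≤-trans (≤-reflexive (*-assoc (suc q) K c′)) (m≤n+m (suc q * (K * c′)) (suc q * (suc N * D))))
-- Now t = N + 1 - (q+1) K is a natural number, so `c′≤` may be multiplied by it.
... | inj₂ large with t , qK+t≡ ← m≤n⇒∃[o]m+o≡n large = *-cancelˡ-≤ (suc m) (begin
  suc m * (suc N * c′)                                          ≡⟨ cong (λ z → suc m * (z * c′)) qK+t≡ ⟨
  suc m * ((suc q * K + t) * c′)                                ≡⟨ expand m (suc q * K) t c′ ⟩
  t * (suc m * c′) + suc m * (suc q * K * c′)                   ≤⟨ +-monoˡ-≤ _ (*-monoʳ-≤ t c′≤) ⟩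
  t * (suc N * c) + suc m * (suc q * K * c′)                    ≡⟨ cong (_+ suc m * (suc q * K * c′)) (swap t (suc N) c) ⟩
  suc N * (t * c) + suc m * (suc q * K * c′)                    ≤⟨ +-monoˡ-≤ _ (*-monoʳ-≤ (suc N) tc≤) ⟩
  suc N * (suc q * (suc m * D)) + suc m * (suc q * K * c′)      ≡⟨ collect (suc N) (suc q) (suc m) D K c′ ⟩
  suc m * (suc q * (suc N * D) + suc q * (K * c′))              ∎)
  where
  open ≤-Reasoning
  expand : ∀ m a t c → suc m * ((a + t) * c) ≡ t * (suc m * c) + suc m * (a * c)
  expand = solve-∀
  swap : ∀ a b c → a * (b * c) ≡ b * (a * c)
  swap = solve-∀
  collect : ∀ N q m D K c → N * (q * (m * D)) + m * (q * K * c) ≡ m * (q * (N * D) + q * (K * c))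
  collect = solve-∀
  tc≤ : t * c ≤ suc q * (suc m * D)
  tc≤ = +-cancelˡ-≤ (suc q * K * c) _ _ (≤-trans (≤-reflexive (trans (sym (*-distribʳ-+ c (suc q * K) t)) (cong (_* c) qK+t≡))) h)

-- Finite sums

∑-zero : ∀ {n} (f : Fin n → ℕ) → (∀ x → f x ≡ 0) → sum f ≡ 0
∑-zero {n} f f≡0 = trans (sum-cong-≗ f≡0) (sum-replicate-zero n)

∑-single : ∀ {n} (f : Fin n → ℕ) i → (∀ x → x ≢ i → f x ≡ 0) → sum f ≡ f i
∑-single f zero    f≡0 = trans (cong (f zero +_) (∑-zero (f ∘ suc) (λ x → f≡0 (suc x) λ ()))) (+-identityʳ (f zero))
∑-single f (suc i) f≡0 = trans (cong (_+ sum (f ∘ suc)) (f≡0 zero λ ()))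
  (∑-single (f ∘ suc) i (λ x x≢i → f≡0 (suc x) (x≢i ∘ Fin.suc-injective)))

∑-↑ : ∀ m {n} (f : Fin (m + n) → ℕ) → sum f ≡ sum (f ∘ (_↑ˡ n)) + sum (f ∘ (m ↑ʳ_))
∑-↑ zero    f = refl
∑-↑ (suc m) f = trans (cong (f zero +_) (∑-↑ m (f ∘ suc))) (sym (+-assoc (f zero) _ _))

∑-lookup : ∀ {a} {A : Set a} (g : A → ℕ) xs → ∑[ i < length xs ] g (List.lookup xs i) ≡ sumᴸ (List.map g xs)
∑-lookup g []       = refl
∑-lookup g (x ∷ xs) = cong (g x +_) (∑-lookup g xs)

∑-const : ∀ n s → ∑[ i < n ] s ≡ n * s
∑-const zero    s = refl
∑-const (suc n) s = cong (s +_) (∑-const n s)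

∣-∑ : ∀ q {n} (f : Fin n → ℕ) → (∀ i → q ∣ₙ f i) → q ∣ₙ sum f
∣-∑ q {zero}  f h = q ∣0
∣-∑ q {suc n} f h = ∣m∣n⇒∣m+n (h zero) (∣-∑ q (f ∘ suc) (h ∘ suc))

sum-map-filter : ∀ {a p} {A : Set a} {P : Pred A p} (P? : Decidable P) (g : A → ℕ) xs →
  sumᴸ (List.map g (filter P? xs)) ≡ sumᴸ (List.map (λ x → if does (P? x) then g x else 0) xs)
sum-map-filter P? g []       = refl
sum-map-filter P? g (x ∷ xs) with does (P? x)
... | true  = cong (g x +_) (sum-map-filter P? g xs)
... | false = sum-map-filter P? g xs

sum-map-allFin : ∀ {n} (g : Fin n → ℕ) → sumᴸ (List.map g (allFin n)) ≡ sum g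
sum-map-allFin g = trans (cong sumᴸ (map-tabulate id g)) (sum-tabulate g)
  where
  sum-tabulate : ∀ {n} (g : Fin n → ℕ) → sumᴸ (List.tabulate g) ≡ sum g
  sum-tabulate {zero}  g = refl
  sum-tabulate {suc n} g = cong (g zero +_) (sum-tabulate (g ∘ suc))

sum-map-cartesianProduct : ∀ {a b} {A : Set a} {B : Set b} (g : A × B → ℕ) xs ys →
  sumᴸ (List.map g (cartesianProduct xs ys)) ≡ sumᴸ (List.map (λ x → sumᴸ (List.map (λ y → g (x , y)) ys)) xs)
sum-map-cartesianProduct g []       ys = refl
sum-map-cartesianProduct g (x ∷ xs) ys = begin
  sumᴸ (List.map g (List.map (x ,_) ys List.++ cartesianProduct xs ys))
    ≡⟨ cong sumᴸ (map-++ g (List.map (x ,_) ys) _) ⟩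
  sumᴸ (List.map g (List.map (x ,_) ys) List.++ List.map g (cartesianProduct xs ys))
    ≡⟨ sum-++ (List.map g (List.map (x ,_) ys)) _ ⟩
  sumᴸ (List.map g (List.map (x ,_) ys)) + sumᴸ (List.map g (cartesianProduct xs ys))
    ≡⟨ cong₂ _+_ (cong sumᴸ (sym (map-∘ ys))) (sum-map-cartesianProduct g xs ys) ⟩
  _ ∎
  where open ≡-Reasoning

sum-map-one : ∀ {a} {A : Set a} (xs : List A) → sumᴸ (List.map (λ _ → 1) xs) ≡ length xs
sum-map-one []       = refl
sum-map-one (x ∷ xs) = cong suc (sum-map-one xs)

-- Injections between finite sets

-- If y were missed, deleting it from the codomain would inject m elements into n - 1, against n ≤
-- m.
injective⇒surjective : ∀ {m n} (φ : Fin m → Fin n) → Injective _≡_ _≡_ φ → n ≤ m → ∀ y → ∃[ x ] φ x ≡ y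
injective⇒surjective {n = suc n} φ inj n≤m y with any? (λ x → φ x Fin.≟ y)
... | yes hit = hit
... | no miss = contradiction (≤-trans n≤m (injective⇒≤ {f = λ x → punchOut (y≢φ x)} (inj ∘ punchOut-injective (y≢φ _) (y≢φ _)))) 1+n≰n
  where
  y≢φ : ∀ x → y ≢ φ x
  y≢φ x y≡φx = miss (x , sym y≡φx)

-- The injection is a bijection by counting, so the sum is only reindexed. For a copy of an
-- expansion this expresses that the copy is spanning.
∑-injective : ∀ {m n} (w : Fin n → ℕ) (φ : Fin m → Fin n) → Injective _≡_ _≡_ φ → n ≤ m → sum (w ∘ φ) ≡ sum w
∑-injective w φ inj n≤m = sym (∑-permute w (permutation φ (proj₁ ∘ surj) (proj₂ ∘ surj) (λ x → inj (proj₂ (surj (φ x))))))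
  where surj = injective⇒surjective φ inj n≤m

-- Weights of subsets

weight-⊥ : ∀ {N} (w : Fin N → ℕ) → weight w ⊥ ≡ 0
weight-⊥ {zero}  w = refl
weight-⊥ {suc N} w = weight-⊥ (w ∘ suc)

weight-⊤ : ∀ {N} (w : Fin N → ℕ) → weight w ⊤ ≡ sum w
weight-⊤ {zero}  w = refl
weight-⊤ {suc N} w = cong (w zero +_) (weight-⊤ (w ∘ suc))

weight-⁅⁆ : ∀ {N} (w : Fin N → ℕ) x → weight w ⁅ x ⁆ ≡ w x
weight-⁅⁆ w zero    = trans (cong (w zero +_) (weight-⊥ (w ∘ suc))) (+-identityʳ (w zero))
weight-⁅⁆ w (suc x) = weight-⁅⁆ (w ∘ suc) x

weight-pair : ∀ {N} (w : Fin N → ℕ) {x y} → x ≢ y → weight w (⁅ x ⁆ ∪ ⁅ y ⁆) ≡ w x + w y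
weight-pair w {zero}  {zero}  x≢y = contradiction refl x≢y
weight-pair w {zero}  {suc y} x≢y = cong (w zero +_) (trans (cong (weight (w ∘ suc)) (∪-identityˡ ⁅ y ⁆)) (weight-⁅⁆ (w ∘ suc) y))
weight-pair w {suc x} {zero}  x≢y = trans (cong (w zero +_) (trans (cong (weight (w ∘ suc)) (∪-identityʳ ⁅ x ⁆)) (weight-⁅⁆ (w ∘ suc) x))) (+-comm (w zero) _)
weight-pair w {suc x} {suc y} x≢y = weight-pair (w ∘ suc) (x≢y ∘ cong suc)

weight-++ : ∀ {m n} (w : Fin (m + n) → ℕ) (p : Subset m) (r : Subset n) →
  weight w (p Vec.++ r) ≡ weight (w ∘ (_↑ˡ n)) p + weight (w ∘ (m ↑ʳ_)) r
weight-++ w []      r = refl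
weight-++ w (b ∷ p) r = trans (cong ((if b then w zero else 0) +_) (weight-++ (w ∘ suc) p r)) (sym (+-assoc (if b then w zero else 0) _ _))

weight-concat-⊥ : ∀ M {j} (w : Fin (M * j) → ℕ) → weight w (concat (replicate M ⊥)) ≡ 0
weight-concat-⊥ zero    w = refl
weight-concat-⊥ (suc M) {j} w = trans (weight-++ w ⊥ (concat (replicate M ⊥)))
  (cong₂ _+_ (weight-⊥ (w ∘ (_↑ˡ (M * j)))) (weight-concat-⊥ M (w ∘ (j ↑ʳ_))))

-- The M blocks partition the new vertices, so every label enters exactly once.
∑-weight-blocks : ∀ M {j} (w : Fin (M * j) → ℕ) → ∑[ i < M ] weight w (concat (replicate M ⊥ [ i ]≔ ⊤)) ≡ sum w
∑-weight-blocks zero    w = refl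
∑-weight-blocks (suc M) {j} w = begin
  weight w (⊤ Vec.++ concat (replicate M ⊥)) + ∑[ i < M ] weight w (⊥ Vec.++ concat (replicate M ⊥ [ i ]≔ ⊤))
    ≡⟨ cong₂ _+_ head (sum-cong-≗ tail) ⟩
  sum (w ∘ (_↑ˡ (M * j))) + ∑[ i < M ] weight (w ∘ (j ↑ʳ_)) (concat (replicate M ⊥ [ i ]≔ ⊤))
    ≡⟨ cong (sum (w ∘ (_↑ˡ (M * j))) +_) (∑-weight-blocks M (w ∘ (j ↑ʳ_))) ⟩
  sum (w ∘ (_↑ˡ (M * j))) + sum (w ∘ (j ↑ʳ_))
    ≡⟨ ∑-↑ j w ⟨
  sum w ∎
  where
  open ≡-Reasoning
  head : weight w (⊤ Vec.++ concat (replicate M ⊥)) ≡ sum (w ∘ (_↑ˡ (M * j)))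
  head = trans (weight-++ w ⊤ (concat (replicate M ⊥)))
    (trans (cong₂ _+_ (weight-⊤ (w ∘ (_↑ˡ (M * j)))) (weight-concat-⊥ M (w ∘ (j ↑ʳ_)))) (+-identityʳ _))
  tail : ∀ i → weight w (⊥ Vec.++ concat (replicate M ⊥ [ i ]≔ ⊤)) ≡ weight (w ∘ (j ↑ʳ_)) (concat (replicate M ⊥ [ i ]≔ ⊤))
  tail i = trans (weight-++ w ⊥ (concat (replicate M ⊥ [ i ]≔ ⊤)))
    (cong (_+ weight (w ∘ (j ↑ʳ_)) (concat (replicate M ⊥ [ i ]≔ ⊤))) (weight-⊥ (w ∘ (_↑ˡ (M * j)))))

-- By injectivity a vertex of the image has a unique preimage in e, so its indicator is a sum over
-- all x. Exchanging the two sums leaves one term for each x in e.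
weight-image : ∀ {m N} (w : Fin N → ℕ) (φ : Fin m → Fin N) → Injective _≡_ _≡_ φ → ∀ e →
  weight w (image φ e) ≡ weight (w ∘ φ) e
weight-image {m} {N} w φ inj e = begin
  ∑[ y < N ] (if lookup (image φ e) y then w y else 0)   ≡⟨ sum-cong-≗ fibre ⟩
  ∑[ y < N ] ∑[ x < m ] term x y                          ≡⟨ ∑-comm (λ y x → term x y) ⟩
  ∑[ x < m ] ∑[ y < N ] term x y                          ≡⟨ sum-cong-≗ row ⟩
  ∑[ x < m ] (if lookup e x then w (φ x) else 0)          ∎
  where
  open ≡-Reasoning
  term : Fin m → Fin N → ℕ
  term x y = if lookup e x then (if does (φ x Fin.≟ y) then w y else 0) else 0
  term-hit : ∀ x y → lookup e x ≡ true → φ x ≡ y → term x y ≡ w y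
  term-hit x y x∈e φx≡y rewrite x∈e with φ x Fin.≟ y
  ... | yes _ = refl
  ... | no φx≢y = contradiction φx≡y φx≢y
  term-miss : ∀ x y → ¬ (x ∈ e × φ x ≡ y) → term x y ≡ 0
  term-miss x y miss with lookup e x in x∈e | φ x Fin.≟ y
  ... | false | _     = refl
  ... | true  | no _  = refl
  ... | true  | yes φx≡y = contradiction (lookup⇒[]= x e x∈e , φx≡y) miss
  fibre : ∀ y → (if lookup (image φ e) y then w y else 0) ≡ ∑[ x < m ] term x y
  fibre y rewrite lookup∘tabulate (λ y → does (any? λ x → (x ∈? e) ×-dec (φ x Fin.≟ y))) y
    with any? (λ x → (x ∈? e) ×-dec (φ x Fin.≟ y))
  ... | yes (i , i∈e , φi≡y) = sym (trans
          (∑-single (λ x → term x y) i (λ x x≢i → term-miss x y (λ (_ , φx≡y) → x≢i (inj (trans φx≡y (sym φi≡y))))))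
          (term-hit i y ([]=⇒lookup i∈e) φi≡y))
  ... | no miss = sym (∑-zero (λ x → term x y) (λ x → term-miss x y (λ hit → miss (x , hit))))
  row : ∀ x → ∑[ y < N ] term x y ≡ (if lookup e x then w (φ x) else 0)
  row x with lookup e x in x∈e
  ... | false = ∑-zero {N} (λ _ → 0) (λ _ → refl)
  ... | true  = trans (∑-single (λ y → if does (φ x Fin.≟ y) then w y else 0) (φ x) off) on
    where
    off : ∀ y → y ≢ φ x → (if does (φ x Fin.≟ y) then w y else 0) ≡ 0
    off y y≢ with φ x Fin.≟ y
    ... | yes φx≡y = contradiction (sym φx≡y) y≢
    ... | no _ = refl
    on : (if does (φ x Fin.≟ φ x) then w (φ x) else 0) ≡ w (φ x)
    on with φ x Fin.≟ φ x
    ... | yes _ = refl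
    ... | no ≢ = contradiction refl ≢

-- Graphs

degree-∑ : ∀ {n} (T : Graph n) u → degree T u ≡ ∑[ v < n ] (if does (adj? T u v) then 1 else 0)
degree-∑ {n} T u = begin
  degree T u                                                    ≡⟨ sum-map-one (filter (adj? T u) (allFin n)) ⟨
  sumᴸ (List.map (λ _ → 1) (filter (adj? T u) (allFin n)))      ≡⟨ sum-map-filter (adj? T u) (λ _ → 1) (allFin n) ⟩
  sumᴸ (List.map (λ v → if does (adj? T u v) then 1 else 0) (allFin n)) ≡⟨ sum-map-allFin (λ v → if does (adj? T u v) then 1 else 0) ⟩
  ∑[ v < n ] (if does (adj? T u v) then 1 else 0)               ∎
  where open ≡-Reasoning

-- The weighted handshake lemma: the value at u is collected once for every edge at u. Interchanging
-- the sums in the second half turns `ψ v` into `ψ u`, after which both orientations of a pair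
-- combine to its adjacency indicator.
handshake : ∀ {n} (T : Graph n) (ψ : Fin n → ℕ) →
  ∑[ i < ∥ T ∥ ] (ψ (proj₁ (List.lookup (graphEdges T) i)) + ψ (proj₂ (List.lookup (graphEdges T) i)))
    ≡ ∑[ u < n ] (degree T u * ψ u)
handshake {n} T ψ = begin
  ∑[ i < ∥ T ∥ ] g (List.lookup (graphEdges T) i)
    ≡⟨ ∑-lookup g (graphEdges T) ⟩
  sumᴸ (List.map g (graphEdges T))
    ≡⟨ sum-map-filter edge g (cartesianProduct (allFin n) (allFin n)) ⟩
  sumᴸ (List.map h (cartesianProduct (allFin n) (allFin n)))
    ≡⟨ sum-map-cartesianProduct h (allFin n) (allFin n) ⟩
  sumᴸ (List.map (λ u → sumᴸ (List.map (λ v → h (u , v)) (allFin n))) (allFin n))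
    ≡⟨ sum-map-allFin (λ u → sumᴸ (List.map (λ v → h (u , v)) (allFin n))) ⟩
  ∑[ u < n ] sumᴸ (List.map (λ v → h (u , v)) (allFin n))
    ≡⟨ sum-cong-≗ (λ u → sum-map-allFin (λ v → h (u , v))) ⟩
  ∑[ u < n ] ∑[ v < n ] h (u , v)
    ≡⟨ sum-cong-≗ (λ u → trans (sum-cong-≗ (λ v → h-split u v)) (∑-distrib-+ (λ v → c u v * ψ u) (λ v → c u v * ψ v))) ⟩
  ∑[ u < n ] (∑[ v < n ] (c u v * ψ u) + ∑[ v < n ] (c u v * ψ v))
    ≡⟨ ∑-distrib-+ (λ u → ∑[ v < n ] (c u v * ψ u)) _ ⟩
  ∑[ u < n ] ∑[ v < n ] (c u v * ψ u) + ∑[ u < n ] ∑[ v < n ] (c u v * ψ v)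
    ≡⟨ cong (sum (λ u → ∑[ v < n ] (c u v * ψ u)) +_) (∑-comm (λ u v → c u v * ψ v)) ⟩
  ∑[ u < n ] ∑[ v < n ] (c u v * ψ u) + ∑[ u < n ] ∑[ v < n ] (c v u * ψ u)
    ≡⟨ ∑-distrib-+ (λ u → ∑[ v < n ] (c u v * ψ u)) _ ⟨
  ∑[ u < n ] (∑[ v < n ] (c u v * ψ u) + ∑[ v < n ] (c v u * ψ u))
    ≡⟨ sum-cong-≗ (λ u → trans (sym (∑-distrib-+ (λ v → c u v * ψ u) (λ v → c v u * ψ u))) (sum-cong-≗ (merge u))) ⟩
  ∑[ u < n ] ∑[ v < n ] ((if does (adj? T u v) then 1 else 0) * ψ u)
    ≡⟨ sum-cong-≗ (λ u → trans (sym (*-distribʳ-sum (ψ u) (λ v → if does (adj? T u v) then 1 else 0))) (cong (_* ψ u) (sym (degree-∑ T u)))) ⟩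
  ∑[ u < n ] (degree T u * ψ u) ∎
  where
  open ≡-Reasoning
  g h : Fin n × Fin n → ℕ
  edge : (e : Fin n × Fin n) → Dec (proj₁ e Fin.< proj₂ e × Adj T (proj₁ e) (proj₂ e))
  edge (u , v) = (u Fin.<? v) ×-dec adj? T u v
  g (u , v) = ψ u + ψ v
  h e = if does (edge e) then g e else 0
  c : Fin n → Fin n → ℕ
  c u v = if does (edge (u , v)) then 1 else 0
  h-split : ∀ u v → h (u , v) ≡ c u v * ψ u + c u v * ψ v
  h-split u v with does (edge (u , v))
  ... | true  = sym (cong₂ _+_ (*-identityˡ (ψ u)) (*-identityˡ (ψ v)))
  ... | false = refl
  merge : ∀ u v → c u v * ψ u + c v u * ψ u ≡ (if does (adj? T u v) then 1 else 0) * ψ u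
  merge u v = trans (sym (*-distribʳ-+ (ψ u) (c u v) (c v u))) (cong (_* ψ u) c+c)
    where
    by-orientation : (p? : Dec (u Fin.< v)) (r? : Dec (v Fin.< u)) (a? : Dec (Adj T u v)) (b? : Dec (Adj T v u)) →
      (if does (p? ×-dec a?) then 1 else 0) + (if does (r? ×-dec b?) then 1 else 0) ≡ (if does a? then 1 else 0)
    by-orientation (yes u<v) (yes v<u) _        _        = contradiction u<v (<-asym v<u)
    by-orientation (yes _)   (no _)    (yes _)  _        = refl
    by-orientation (yes _)   (no _)    (no _)   _        = refl
    by-orientation (no _)    (yes _)   (yes _)  (yes _)  = refl
    by-orientation (no _)    (yes _)   (no _)   (no _)   = refl
    by-orientation (no _)    (yes _)   (yes uv) (no ¬vu) = contradiction (Graph.sym T uv) ¬vu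
    by-orientation (no _)    (yes _)   (no ¬uv) (yes vu) = contradiction (Graph.sym T vu) ¬uv
    by-orientation (no _)    (no _)    (no _)   _        = refl
    -- Incomparable vertices coincide, and loops are excluded.
    by-orientation (no u≮v)  (no v≮u)  (yes uv) _        =
      contradiction uv (irrefl T (Fin.toℕ-injective (≤-antisym (≮⇒≥ v≮u) (≮⇒≥ u≮v))))
    c+c : c u v + c v u ≡ (if does (adj? T u v) then 1 else 0)
    c+c = by-orientation (u Fin.<? v) (v Fin.<? u) (adj? T u v) (adj? T v u)

-- The map deletes i from the codomain and sends i itself to the place of j. It serves to merge two
-- classes of vertices.
identify : ∀ {c} {i j : Fin (suc c)} → i ≢ j →
  ∃ λ (g : Fin (suc c) → Fin c) → (∀ y → ∃[ x ] g x ≡ y) × g i ≡ g j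
identify {c} {i} {j} i≢j = g , (λ y → punchIn i y , onto y) , glue
  where
  g : Fin (suc c) → Fin c
  g x with i Fin.≟ x
  ... | yes _   = punchOut i≢j
  ... | no i≢x  = punchOut i≢x
  onto : ∀ y → g (punchIn i y) ≡ y
  onto y with i Fin.≟ punchIn i y
  ... | yes i≡ = contradiction (sym i≡) (punchInᵢ≢i i y)
  ... | no _   = trans (punchOut-cong i refl) (punchOut-punchIn i)
  glue : g i ≡ g j
  glue with i Fin.≟ i | i Fin.≟ j
  ... | no i≢i | _       = contradiction refl i≢i
  ... | yes _  | yes _   = refl
  ... | yes _  | no _    = punchOut-cong i refl

-- Starting from singletons, each edge either lies inside a class or merges two classes, so it
-- lowers the number of classes by at most one.
components : ∀ {n} (E : List (Fin n × Fin n)) →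
  ∃₂ λ c (f : Fin n → Fin c) → (∀ y → ∃[ x ] f x ≡ y) × n ≤ c + length E × All (λ (u , v) → f u ≡ f v) E
components {n} [] = n , id , (λ y → y , refl) , ≤-reflexive (sym (+-identityʳ n)) , []
components {n} ((u , v) ∷ E) with components E
... | zero , f , _ , _ = contradiction (f u) Fin.¬Fin0
... | suc c , f , onto , n≤ , const with f u Fin.≟ f v
...   | yes fu≡fv = suc c , f , onto , ≤-trans n≤ (+-monoʳ-≤ (suc c) (n≤1+n (length E))) , fu≡fv ∷ const
...   | no fu≢fv with g , g-onto , gfu≡gfv ← identify fu≢fv =
        c , g ∘ f ,
        (λ y → let (z , gz≡y) = g-onto y ; (x , fx≡z) = onto z in x , trans (cong g fx≡z) gz≡y) ,
        ≤-trans n≤ (≤-reflexive (sym (+-suc c (length E)))) ,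
        gfu≡gfv ∷ All.map (cong g) const

adj⇒∈graphEdges : ∀ {n} (T : Graph n) {u v} → Adj T u v → (u , v) ∈ᴸ graphEdges T ⊎ (v , u) ∈ᴸ graphEdges T
adj⇒∈graphEdges T {u} {v} uv with Fin.<-cmp u v
... | tri< u<v _ _ = inj₁ (∈-filter⁺ _ (∈-cartesianProduct⁺ (∈-allFin u) (∈-allFin v)) (u<v , uv))
... | tri≈ _ u≡v _ = contradiction uv (irrefl T u≡v)
... | tri> _ _ v<u = inj₂ (∈-filter⁺ _ (∈-cartesianProduct⁺ (∈-allFin v) (∈-allFin u)) (v<u , Graph.sym T uv))

-- A map constant along edges is constant along walks, so connectedness leaves at most one of the
-- classes from `components`.
connected⇒n≤1+∥T∥ : ∀ {n} (T : Graph n) → Connected T → n ≤ suc ∥ T ∥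
connected⇒n≤1+∥T∥ {n} T conn with c , f , onto , n≤ , const ← components (graphEdges T) =
  ≤-trans n≤ (+-monoˡ-≤ ∥ T ∥ (c≤1 c f onto step))
  where
  step : ∀ {u v} → Adj T u v → f u ≡ f v
  step uv with adj⇒∈graphEdges T uv
  ... | inj₁ ∈E = All.lookup const ∈E
  ... | inj₂ ∈E = sym (All.lookup const ∈E)
  c≤1 : ∀ c (f : Fin n → Fin c) → (∀ y → ∃[ x ] f x ≡ y) → (∀ {u v} → Adj T u v → f u ≡ f v) → c ≤ 1
  c≤1 zero          f onto step = z≤n
  c≤1 (suc zero)    f onto step = ≤-refl
  c≤1 (suc (suc c)) f onto step with u , fu≡0 ← onto zero | v , fv≡1 ← onto (suc zero) =
    contradiction (trans (sym fu≡0) (trans (walk (conn u v)) fv≡1)) λ ()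
    where
    walk : ∀ {u v} → Star (Adj T) u v → f u ≡ f v
    walk ε          = refl
    walk (uv ◅ vs) = trans (step uv) (walk vs)

-- Copies of an expansion

endpoints : ∀ {n} (T : Graph n) → Fin ∥ T ∥ → Fin n × Fin n
endpoints T = List.lookup (graphEdges T)

endpoints-distinct : ∀ {n} (T : Graph n) i → proj₁ (endpoints T i) ≢ proj₂ (endpoints T i)
endpoints-distinct {n} T i u≡v =
  Fin.<-irrefl u≡v (proj₁ (All.lookup (all-filter _ (cartesianProduct (allFin n) (allFin n))) (∈-lookup i)))

weight-expansionEdge : ∀ {n} k (T : Graph n) (w : Fin (n + ∥ T ∥ * (k ∸ 2)) → ℕ) i →
  weight w (expansionEdge k T i) ≡
  (w (proj₁ (endpoints T i) ↑ˡ _) + w (proj₂ (endpoints T i) ↑ˡ _)) +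
  weight (w ∘ (n ↑ʳ_)) (concat (replicate ∥ T ∥ ⊥ [ i ]≔ ⊤))
weight-expansionEdge {n} k T w i = trans
  (weight-++ w (⁅ proj₁ (endpoints T i) ⁆ ∪ ⁅ proj₂ (endpoints T i) ⁆) (concat (replicate ∥ T ∥ ⊥ [ i ]≔ ⊤)))
  (cong (_+ weight (w ∘ (n ↑ʳ_)) (concat (replicate ∥ T ∥ ⊥ [ i ]≔ ⊤)))
    (weight-pair (w ∘ (_↑ˡ (∥ T ∥ * (k ∸ 2)))) (endpoints-distinct T i)))

-- A vertex of T lies in as many expanded edges as its degree, by `handshake`; a new vertex lies
-- only in the edge of its block.
∑-weight-expansionEdge : ∀ {n} k (T : Graph n) (w : Fin (n + ∥ T ∥ * (k ∸ 2)) → ℕ) →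
  ∑[ i < ∥ T ∥ ] weight w (expansionEdge k T i) ≡
  ∑[ u < n ] (degree T u * w (u ↑ˡ _)) + sum (w ∘ (n ↑ʳ_))
∑-weight-expansionEdge {n} k T w = begin
  ∑[ i < M ] weight w (expansionEdge k T i)                    ≡⟨ sum-cong-≗ (weight-expansionEdge k T w) ⟩
  ∑[ i < M ] (pair i + block i)                                ≡⟨ ∑-distrib-+ pair block ⟩
  sum pair + sum block                                         ≡⟨ cong₂ _+_ (handshake T (w ∘ (_↑ˡ _))) (∑-weight-blocks M (w ∘ (n ↑ʳ_))) ⟩
  ∑[ u < n ] (degree T u * w (u ↑ˡ _)) + sum (w ∘ (n ↑ʳ_))     ∎
  where
  open ≡-Reasoning
  M = ∥ T ∥
  pair block : Fin M → ℕ
  pair i = w (proj₁ (endpoints T i) ↑ˡ _) + w (proj₂ (endpoints T i) ↑ˡ _)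
  block i = weight (w ∘ (n ↑ʳ_)) (concat (replicate M ⊥ [ i ]≔ ⊤))

-- In a spanning copy every vertex is counted, up to multiples of q, exactly once.
copy-total : ∀ {n N} k q s (T : Graph n) → (∀ v → ∃[ t ] degree T v ≡ 1 + t * q) → N ≤ n + ∥ T ∥ * (k ∸ 2) →
  Contains (divisibleWeight N k q s) (expansion k T) → q ∣ₙ sum {N} toℕ + ∥ T ∥ * s
copy-total {n} {N} k q s T deg≡ N≤ (φ , φ-inj , φ-edge) =
  ∣m+n∣m⇒∣n (subst (q ∣ₙ_) total (∣-∑ q (λ i → weight toℕ (image φ (expansionEdge k T i)) + s) (λ i → proj₂ (φ-edge _ (i , refl)))))
    (∣-∑ q (λ u → q * (t u * x u)) (λ u → m∣m*n (t u * x u)))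
  where
  open ≡-Reasoning
  M = ∥ T ∥
  w = toℕ ∘ φ
  x : Fin n → ℕ
  x u = w (u ↑ˡ _)
  t : Fin n → ℕ
  t u = proj₁ (deg≡ u)
  spread : ∀ t q x → (1 + t * q) * x ≡ q * (t * x) + x
  spread = solve-∀
  regroup : ∀ a b c d → ((a + b) + c) + d ≡ a + ((b + c) + d)
  regroup = solve-∀
  total : ∑[ i < M ] (weight toℕ (image φ (expansionEdge k T i)) + s) ≡ ∑[ u < n ] (q * (t u * x u)) + (sum {N} toℕ + M * s)
  total = begin
    ∑[ i < M ] (weight toℕ (image φ (expansionEdge k T i)) + s)
      ≡⟨ ∑-distrib-+ (λ i → weight toℕ (image φ (expansionEdge k T i))) (λ _ → s) ⟩
    ∑[ i < M ] weight toℕ (image φ (expansionEdge k T i)) + ∑[ i < M ] s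
      ≡⟨ cong₂ _+_ (sum-cong-≗ (λ i → weight-image toℕ φ φ-inj (expansionEdge k T i))) (∑-const M s) ⟩
    ∑[ i < M ] weight w (expansionEdge k T i) + M * s
      ≡⟨ cong (_+ M * s) (∑-weight-expansionEdge k T w) ⟩
    (∑[ u < n ] (degree T u * x u) + sum (w ∘ (n ↑ʳ_))) + M * s
      ≡⟨ cong (λ z → (z + sum (w ∘ (n ↑ʳ_))) + M * s) (trans
           (sum-cong-≗ (λ u → trans (cong (_* x u) (proj₂ (deg≡ u))) (spread (t u) q (x u))))
           (∑-distrib-+ (λ u → q * (t u * x u)) x)) ⟩
    ((∑[ u < n ] (q * (t u * x u)) + sum x) + sum (w ∘ (n ↑ʳ_))) + M * s
      ≡⟨ regroup (sum (λ u → q * (t u * x u))) (sum x) (sum (w ∘ (n ↑ʳ_))) (M * s) ⟩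
    ∑[ u < n ] (q * (t u * x u)) + ((sum x + sum (w ∘ (n ↑ʳ_))) + M * s)
      -- Vertices of T and new vertices together are at least N many, so the copy is spanning and
      -- their labels add up to the total label sum.
      ≡⟨ cong (λ z → sum (λ u → q * (t u * x u)) + (z + M * s)) (trans (sym (∑-↑ n w)) (∑-injective toℕ φ φ-inj N≤)) ⟩
    ∑[ u < n ] (q * (t u * x u)) + (sum {N} toℕ + M * s) ∎

-- For k = 2 the number of new vertices is `∥ T ∥ * 0`, which equals 0 without reducing to it; hence
-- the equation as an argument.
weight-empty : ∀ {N} → N ≡ 0 → (w : Fin N → ℕ) (e : Subset N) → weight w e ≡ 0
weight-empty refl w e = refl

-- For k = q = 2 and s = 0 the graph is the disjoint union of two cliques.
no-expansion-2 : ∀ {n N} (T : Graph n) → Connected T → N ≡ n → 2 ≤ n →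
  ¬ Contains (divisibleWeight N 2 2 0) (expansion 2 T)
no-expansion-2 {n} {N} T conn refl 2≤n (φ , φ-inj , φ-edge)
  with onto ← injective⇒surjective (λ u → φ (u ↑ˡ (∥ T ∥ * 0))) (↑ˡ-injective _ _ _ ∘ φ-inj) ≤-refl
  -- The labels 0 and 1 lie in different cliques, yet a walk in T joins their preimages.
  with u , φu≡0 ← onto (fromℕ< (<⇒≤ 2≤n)) | v , φv≡1 ← onto (fromℕ< 2≤n) =
  contradiction (∣1⇒≡1 (subst₂ (λ a b → 2 ∣ₙ a + b) (value u (<⇒≤ 2≤n) φu≡0) (value v 2≤n φv≡1) (walk (conn u v)))) λ ()
  where
  x : Fin n → ℕ
  x u = toℕ (φ (u ↑ˡ _))
  value : ∀ u {a} (a<n : a < n) → φ (u ↑ˡ _) ≡ fromℕ< a<n → x u ≡ a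
  value u a<n eq = trans (cong toℕ eq) (toℕ-fromℕ< a<n)
  same : ∀ i → 2 ∣ₙ x (proj₁ (endpoints T i)) + x (proj₂ (endpoints T i))
  same i = subst (2 ∣ₙ_) (begin
    weight toℕ (image φ (expansionEdge 2 T i)) + 0  ≡⟨ +-identityʳ _ ⟩
    weight toℕ (image φ (expansionEdge 2 T i))      ≡⟨ weight-image toℕ φ φ-inj (expansionEdge 2 T i) ⟩
    weight (toℕ ∘ φ) (expansionEdge 2 T i)          ≡⟨ weight-expansionEdge 2 T (toℕ ∘ φ) i ⟩
    _                                               ≡⟨ cong (λ z → x (proj₁ (endpoints T i)) + x (proj₂ (endpoints T i)) + z) (weight-empty (*-zeroʳ ∥ T ∥) _ (concat (replicate ∥ T ∥ ⊥ [ i ]≔ ⊤))) ⟩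
    _                                               ≡⟨ +-identityʳ _ ⟩
    x (proj₁ (endpoints T i)) + x (proj₂ (endpoints T i)) ∎) (proj₂ (φ-edge _ (i , refl)))
    where open ≡-Reasoning
  same-∈ : ∀ {u v} → (u , v) ∈ᴸ graphEdges T → 2 ∣ₙ x u + x v
  same-∈ uv∈E = subst (λ (u , v) → 2 ∣ₙ x u + x v) (sym (lookup-index uv∈E)) (same (index uv∈E))
  step : ∀ {u v} → Adj T u v → 2 ∣ₙ x u + x v
  step {u} {v} uv with adj⇒∈graphEdges T uv
  ... | inj₁ uv∈E = same-∈ uv∈E
  ... | inj₂ vu∈E = subst (2 ∣ₙ_) (+-comm (x v) (x u)) (same-∈ vu∈E)
  double : ∀ a → a * 2 ≡ a + a
  double = solve-∀
  chain : ∀ a b c → (a + b) + (b + c) ≡ b * 2 + (a + c)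
  chain = solve-∀
  walk : ∀ {u v} → Star (Adj T) u v → 2 ∣ₙ x u + x v
  walk {u} ε = divides (x u) (sym (double (x u)))
  -- The intermediate label occurs twice in the sum of both parts, so it drops out modulo 2.
  walk {u} {v} (_◅_ {j = z} uz zv) = ∣m+n∣m⇒∣n (subst (2 ∣ₙ_) (chain (x u) (x z) (x v)) (∣m∣n⇒∣m+n (step uz) (walk zv))) (n∣m*n (x z))

-- Below n only m = n - 1 remains, at distance 1, which q > 1 does not divide. This excludes n = 1
-- for the order of the tree and degree 0 for its vertices.
congruent-ℕ : ∀ {q} m n → 1 < q → n ≤ suc m → q ∣ₙ ℤ.∣ ℤ.+ m ℤ.- ℤ.+ n ∣ → ∃[ t ] m ≡ n + t * q
congruent-ℕ {q} m n 1<q n≤1+m q∣ with n ≤? m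
... | yes n≤m = _∣ₙ_.quotient q∣m∸n , trans (sym (m+[n∸m]≡n n≤m)) (cong (n +_) (_∣ₙ_.equality q∣m∸n))
  where
  distance : ℤ.∣ ℤ.+ m ℤ.- ℤ.+ n ∣ ≡ m ∸ n
  distance = trans (cong ℤ.∣_∣ (ℤ.m-n≡m⊖n m n)) (trans (ℤ.∣m⊖n∣≡∣n⊖m∣ m n) (ℤ.∣⊖∣-≤ n≤m))
  q∣m∸n : q ∣ₙ m ∸ n
  q∣m∸n = subst (q ∣ₙ_) distance q∣
... | no n≰m = contradiction (∣1⇒≡1 (subst (q ∣ₙ_) distance q∣)) (>⇒≢ 1<q)
  where
  n≡1+m : n ≡ suc m
  n≡1+m = ≤-antisym n≤1+m (≰⇒> n≰m)
  distance : ℤ.∣ ℤ.+ m ℤ.- ℤ.+ n ∣ ≡ 1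
  distance = trans (cong ℤ.∣_∣ (ℤ.m-n≡m⊖n m n)) (trans (ℤ.∣⊖∣-≤ (≰⇒≥ n≰m)) (trans (cong (_∸ m) n≡1+m) (m+n∸n≡m 1 m)))

-- The offset makes W + M s congruent to W q + 1, hence to 1, for the total weight W.
no-expansion-≥3 : ∀ {n N} j q t (T : Graph n) → 1 < suc q → Connected T → n ≡ 2 + t * suc q → N ≡ n + pred n * suc j →
  (∀ v → ∃[ t ] degree T v ≡ 1 + t * suc q) →
  ¬ Contains (divisibleWeight N (3 + j) (suc q) (sum {N} toℕ * q + 1)) (expansion (3 + j) T)
no-expansion-≥3 {n} {N} j q t T 1<q conn n≡ N≡ deg≡ copy@(φ , φ-inj , _) =
  contradiction (∣1⇒≡1 (∣m+n∣m⇒∣n (subst (suc q ∣ₙ_) total (copy-total (3 + j) (suc q) s T deg≡ N≤ copy)) (m∣m*n (W + t * s)))) (>⇒≢ 1<q)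
  where
  W = sum {N} toℕ
  s = W * q + 1
  pred-n : pred n ≡ 1 + t * suc q
  pred-n = cong pred n≡
  pred≤ : pred n ≤ ∥ T ∥
  pred≤ = pred-mono-≤ (connected⇒n≤1+∥T∥ T conn)
  -- The copy has n + `∥ T ∥` (k-2) distinct vertices among N = n + (n-1)(k-2), and the factor k - 2
  -- is positive.
  ≤pred : ∥ T ∥ ≤ pred n
  ≤pred = *-cancelʳ-≤ ∥ T ∥ (pred n) (suc j) (+-cancelˡ-≤ n _ _ (≤-trans (injective⇒≤ φ-inj) (≤-reflexive N≡)))
  N≤ : N ≤ n + ∥ T ∥ * suc j
  N≤ = ≤-trans (≤-reflexive N≡) (+-monoʳ-≤ n (*-monoˡ-≤ (suc j) pred≤))
  ∥T∥≡ : ∥ T ∥ ≡ 1 + t * suc q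
  ∥T∥≡ = trans (≤-antisym ≤pred pred≤) pred-n
  expand : ∀ W q t → W + (1 + t * suc q) * (W * q + 1) ≡ suc q * (W + t * (W * q + 1)) + 1
  expand = solve-∀
  total : W + ∥ T ∥ * s ≡ suc q * (W + t * s) + 1
  total = trans (cong (λ M → W + M * s) ∥T∥≡) (expand W q t)

-- The offset is chosen before T, because a single hypergraph has to avoid all the trees at once.
no-expansion : ∀ {n N} k q t → 2 ≤ k → 1 < q → q ≤ k → n ≡ 2 + t * q → N ≡ n + pred n * (k ∸ 2) →
  ∃[ s ] (∀ (T : Graph n) → IsTree T → (∀ v → ∃[ t ] degree T v ≡ 1 + t * q) →
    ¬ Contains (divisibleWeight N k q s) (expansion k T))
no-expansion {n} (suc (suc zero)) (suc (suc zero)) t 2≤k 1<q q≤k n≡ N≡ = 0 , λ T (conn , _) _ →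
  no-expansion-2 T conn (trans N≡ (trans (cong (n +_) (*-zeroʳ (pred n))) (+-identityʳ n))) (≤-trans (m≤m+n 2 (t * 2)) (≤-reflexive (sym n≡)))
-- For k = 2, the condition q ≤ k leaves only q = 2.
no-expansion (suc (suc zero)) (suc (suc (suc _))) t 2≤k 1<q (s≤s (s≤s ())) n≡ N≡
no-expansion (suc (suc (suc j))) (suc q) t 2≤k 1<q q≤k n≡ N≡ = _ , λ T (conn , _) deg≡ →
  no-expansion-≥3 j q t T 1<q conn n≡ N≡ deg≡
no-expansion (suc zero) _ _ (s≤s ())
no-expansion (suc (suc zero)) (suc zero) _ _ (s≤s ())

-- The right-hand side is the order of the k-expansion of an n-vertex tree: n old vertices and k - 2
-- new ones for each of n - 1 edges.
order-formula : ∀ k n → 2 ≤ k → 1 ≤ n → ((k ∸ 1) * n + 2) ∸ k ≡ n + pred n * (k ∸ 2)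
order-formula (suc (suc j)) (suc n) 2≤k 1≤n = trans (cong (_∸ (2 + j)) (split j n)) (m+n∸m≡n (2 + j) (suc n + n * j))
  where
  split : ∀ j n → suc j * suc n + 2 ≡ (2 + j) + (suc n + n * j)
  split = solve-∀
order-formula (suc zero) n (s≤s ())

-- Together with d < k this yields d ≤ N, so that d-subsets exist.
k≤order : ∀ k n → 2 ≤ k → 2 ≤ n → k ≤ n + pred n * (k ∸ 2)
k≤order k n 2≤k 2≤n = begin
  k                          ≡⟨ m+[n∸m]≡n 2≤k ⟨
  2 + (k ∸ 2)                ≡⟨ cong (2 +_) (*-identityˡ (k ∸ 2)) ⟨
  2 + 1 * (k ∸ 2)            ≤⟨ +-mono-≤ 2≤n (*-monoˡ-≤ (k ∸ 2) (pred-mono-≤ 2≤n)) ⟩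
  n + pred n * (k ∸ 2)       ∎
  where open ≤-Reasoning

-- Rational bounds and the conclusion

open import Data.Integer using (+_)
open import Data.Integer.Divisibility using (_∣_)

null-sequence : ∀ a → TendsToZero (λ N → + a / suc N)
null-sequence a (mkℚ (+ zero) _ _)     (*<* (+<+ ()))
null-sequence a (mkℚ ℤ.-[1+ _ ] _ _)   (*<* ())
-- Here ε = (p+1)/(b+1). After cross-multiplication a (b+1) < (p+1)(N+1) is required, which N ≥ a
-- (b+1) ensures.
null-sequence a r@(mkℚ (+ suc p) b _) _ = a * suc b , λ N N≥ →
  subst (ℚ._< r) (sym (ℚ.0≤p⇒∣p∣≡p (ℚ.nonNegative⁻¹ (+ a / suc N) {{ℚ.normalize-nonNeg a (suc N)}})))
    (ℚ.toℚᵘ-cancel-< (ℚᵘ.<-respˡ-≃ (ℚᵘ.≃-sym (ℚ.toℚᵘ-fromℚᵘ (mkℚᵘ (+ a) N)))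
      (ℚᵘ.*<* (subst₂ ℤ._<_ (ℤ.pos-* a (suc b)) (ℤ.pos-* (suc p) (suc N)) (+<+ (bound N N≥))))))
  where
  bound : ∀ N → N ≥ a * suc b → a * suc b < suc p * suc N
  bound N N≥ = ≤-trans (s≤s N≥) (m≤m+n (suc N) (p * suc N))

-- The hypothesis is the conclusion multiplied by (q+1)(N+1), with the negative term moved across.
-- In unnormalised rationals this is plain cross-multiplication, free of reduction to lowest terms.
fraction-bound : ∀ q a N c δ → suc N * c ≤ suc q * (suc N * δ) + suc q * (a * c) →
  ((+ 1 / suc q) ℚ.- (+ a / suc N)) ℚ.* (+ c / 1) ℚ.≤ + δ / 1
fraction-bound q a N c δ h = ℚ.toℚᵘ-cancel-≤ (begin
  toℚᵘ ((x ℚ.- y) ℚ.* z)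
    ≃⟨ ℚ.toℚᵘ-homo-* (x ℚ.- y) z ⟩
  toℚᵘ (x ℚ.- y) ℚᵘ.* toℚᵘ z
    ≃⟨ ℚᵘ.*-cong (ℚᵘ.≃-trans (ℚ.toℚᵘ-homo-+ x (ℚ.- y))
         (ℚᵘ.+-cong (ℚ.toℚᵘ-fromℚᵘ (mkℚᵘ (+ 1) q))
           (ℚᵘ.≃-trans (ℚ.toℚᵘ-homo‿- y) (ℚᵘ.-‿cong (ℚ.toℚᵘ-fromℚᵘ (mkℚᵘ (+ a) N))))))
         (ℚ.toℚᵘ-fromℚᵘ (mkℚᵘ (+ c) 0)) ⟩
  (mkℚᵘ (+ 1) q ℚᵘ.- mkℚᵘ (+ a) N) ℚᵘ.* mkℚᵘ (+ c) 0
    ≤⟨ *≤* integral ⟩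
  mkℚᵘ (+ δ) 0
    ≃⟨ ℚ.toℚᵘ-fromℚᵘ (mkℚᵘ (+ δ) 0) ⟨
  toℚᵘ (+ δ / 1) ∎)
  where
  open ℚᵘ.≤-Reasoning
  x = + 1 / suc q
  y = + a / suc N
  z = + c / 1
  expand : ∀ A B C D → ((+ 1 ℤ.* B ℤ.+ ℤ.- A ℤ.* C) ℤ.* D) ℤ.* + 1 ≡ B ℤ.* D ℤ.- C ℤ.* (A ℤ.* D)
  expand = ℤSolver.solve-∀
  cancel : ∀ A B → A ℤ.+ B ℤ.- B ≡ A
  cancel = ℤSolver.solve-∀
  rearrange : ∀ q N δ → q * (N * δ) ≡ δ * (q * N * 1)
  rearrange = solve-∀
  integral : ((+ 1 ℤ.* + suc N ℤ.+ ℤ.- (+ a) ℤ.* + suc q) ℤ.* + c) ℤ.* + 1 ℤ.≤ + δ ℤ.* + (suc q * suc N * 1)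
  integral = ℤ.≤-trans (ℤ.≤-reflexive (trans (expand (+ a) (+ suc N) (+ suc q) (+ c)) pos))
    (ℤ.≤-trans (ℤ.+-monoˡ-≤ (ℤ.- (+ (suc q * (a * c)))) (+≤+ h))
      (ℤ.≤-reflexive (trans (cancel (+ (suc q * (suc N * δ))) (+ (suc q * (a * c))))
        (trans (cong +_ (rearrange (suc q) (suc N) δ)) (ℤ.pos-* δ _)))))
    where
    pos : + suc N ℤ.* + c ℤ.- + suc q ℤ.* (+ a ℤ.* + c) ≡ + (suc N * c) ℤ.- + (suc q * (a * c))
    pos = cong₂ ℤ._-_ (sym (ℤ.pos-* (suc N) c))
      (trans (cong (+ suc q ℤ.*_) (sym (ℤ.pos-* a c))) (sym (ℤ.pos-* (suc q) (a * c))))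

-- The error (k+1)/(N+1) has k from `δ-≥`; the additional 1 in the numerator pays for replacing N by
-- N + 1, which keeps the denominator positive.
δ-fraction : ∀ N q s d m {k l} → k ≡ d + l → l ≡ suc m → d ≤ N →
  ((+ 1 / suc q) ℚ.- (+ suc k / suc N)) ℚ.* (+ ((N ∸ d) C l) / 1) ℚ.≤ + δ d (divisibleWeight N k (suc q) s) / 1
δ-fraction N q s d m refl refl d≤N =
  fraction-bound q (suc (d + suc m)) N ((N ∸ d) C suc m) D
    (rescale N q (suc (d + suc m)) m c ((N ∸ d) C suc m) D
      (≤-trans (C-absorb-≤ (N ∸ d) m) (*-monoˡ-≤ c (≤-trans (m∸n≤m N d) (n≤1+n N))))
      bound)
  where
  D = δ d (divisibleWeight N (d + suc m) (suc q) s)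
  c = (N ∸ d) C m
  open ≤-Reasoning
  regroup : ∀ q d m c D → c + (suc q * suc (d + m) * c + D) + q * c ≡ suc q * suc (d + suc m) * c + D
  regroup = solve-∀
  bound : suc N * c ≤ suc q * suc (d + suc m) * c + suc q * (suc m * D)
  bound = begin
    c + N * c                                                         ≤⟨ +-monoʳ-≤ c (δ-≥ N q s d m d≤N) ⟩
    -- One of the q + 1 additional copies of c absorbs the step from N to N + 1; the other q are
    -- slack.
    c + (suc q * suc (d + m) * c + suc q * (suc m * D))               ≤⟨ m≤m+n _ (q * c) ⟩
    c + (suc q * suc (d + m) * c + suc q * (suc m * D)) + q * c       ≡⟨ regroup q d m c (suc q * (suc m * D)) ⟩
    suc q * suc (d + suc m) * c + suc q * (suc m * D)                 ∎

theorem3p4 : ∀ (k d q : ℕ) → 1 ≤ d → d < k → (1<q : 1 < q) → q ≤ k →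
    let instance q≢0 = >-nonZero (<-trans z<s 1<q) in
    ∃ λ (f : ℕ → ℚ) → TendsToZero f ×
    (∀ (n : ℕ) → 1 ≤ n → + q ∣ + n ℤ.- + 2 →
    let N = ((k ∸ 1) * n + 2) ∸ k in
    ∃ λ (H : Hypergraph N) →
    Uniform k H ×
    ((+ 1 / q) ℚ.- f N) ℚ.* (+ ((N ∸ d) C (k ∸ d)) / 1) ℚ.≤ (+ δ d H / 1) ×
    (∀ (T : Graph n) → IsTree T →
    (∀ v → + degree T v ≡ + 1 [mod + q ]) →
    ¬ Contains H (expansion k T)))
theorem3p4 k d (suc q) 1≤d d<k 1<q q≤k = (λ N → + suc k / suc N) , null-sequence (suc k) , construct
  where
  2≤k : 2 ≤ k
  2≤k = ≤-trans (s≤s 1≤d) d<k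
  construct : ∀ n → 1 ≤ n → + suc q ∣ + n ℤ.- + 2 → _
  construct n 1≤n q∣n-2 =
    let t , n≡ = congruent-ℕ n 2 1<q (s≤s 1≤n) q∣n-2
        N≡ = order-formula k n 2≤k 1≤n
        2≤n = ≤-trans (m≤m+n 2 (t * suc q)) (≤-reflexive (sym n≡))
        d≤N = ≤-trans (<⇒≤ d<k) (≤-trans (k≤order k n 2≤k 2≤n) (≤-reflexive (sym N≡)))
        s , free = no-expansion k (suc q) t 2≤k 1<q q≤k n≡ N≡
    -- The witness m = k - d - 1 counts the vertices added to a d-set before the last one.
    in divisibleWeight _ k (suc q) s , (λ e → proj₁) , δ-fraction _ q s d (k ∸ suc d) (sym (m+[n∸m]≡n (<⇒≤ d<k))) (+-∸-assoc 1 d<k) d≤N ,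
       λ T tree deg≡1 → free T tree (λ v → congruent-ℕ (degree T v) 1 1<q (s≤s z≤n) (deg≡1 v))
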